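{- For every integer $q\ge 0$, $r_{2^q}\le q+1$; equivalently, $r_n\le 1+\lceil\log_2 n\rceil$ for every positive integer $n$.
   Context: For a positive integer $n$, $G(n)$ is the bipartite graph with vertices $x_1,\ldots,x_n$ and $y_1,\ldots,y_n$ whose edges are the pairs $x_iy_j$ with $i\le j$. $r_n$ denotes the smallest $k$ such that the edges of $G(n)$ can be covered by complete bipartite subgraphs of $G(n)$ in such a way that no vertex belongs to more than $k$ of the subgraphs. Equivalently, $r_n$ is the smallest $k$ such that each vertex of $G(n)$ can be given a set of at most $k$ colors so that, for all $i,j$, $x_i$ and $y_j$ share a color if and only if $i\le j$ (the total number of colors used is unrestricted). -}

module Defs where

open import Data.Nat using (ℕ; zero; suc; _+_; _*_; _≤_; _<_; _≤?_; z≤n; s≤s)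
import Data.Nat.Properties as ℕₚ
open import Data.Fin as Fin using (Fin; zero; suc)
import Data.Fin.Properties as Finₚ
open import Data.Fin.Subset using (Subset; _∈_; Nonempty; ⁅_⁆)
open import Data.Fin.Subset.Properties
  using (_∈?_; nonempty?; anySubset?; x∈⁅x⁆; x∈⁅y⁆⇒x≡y)
open import Data.List using (List; []; _∷_; length; filter; map; allFin; cartesianProduct)
import Data.List.Properties as Listₚ
open import Data.List.Relation.Unary.All using (All; all?)
import Data.List.Relation.Unary.All as All
import Data.List.Relation.Unary.All.Properties as Allₚ
open import Data.List.Relation.Unary.Any using (Any; any?)
import Data.List.Relation.Unary.Any as Any
import Data.List.Relation.Unary.Any.Properties as Anyₚ
open import Data.List.Membership.Propositional.Properties
  using (∈-allFin; ∈-cartesianProduct⁺; ∈-filter⁺)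
open import Data.Product using (∃; ∃-syntax; _×_; _,_; proj₁; proj₂; uncurry)
open import Function using (_∘_)
open import Level using (0ℓ)
open import Relation.Binary.PropositionalEquality using (refl; subst; sym)
open import Relation.Nullary using (Dec; yes; no; contradiction)
open import Relation.Nullary.Decidable using (map′; _×-dec_; _→-dec_)
open import Relation.Unary using (Pred; Decidable)

private
  variable
    n k : ℕ

data Vertex (n : ℕ) : Set where
  x y : Fin n → Vertex n

-- `Edge i j` says that xᵢ yⱼ is an edge of G(n); G(n) has no other edges.
Edge : Fin n → Fin n → Set
Edge i j = i Fin.≤ j

-- (A , B) stands for the vertex set {xᵢ : i ∈ A} ∪ {yⱼ : j ∈ B}.
Parts : ℕ → Set
Parts n = Subset n × Subset n

infix 4 _∈ᵥ_ _∈ᵥ?_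

_∈ᵥ_ : Vertex n → Parts n → Set
x i ∈ᵥ (A , B) = i ∈ A
y j ∈ᵥ (A , B) = j ∈ B

_∈ᵥ?_ : (v : Vertex n) → (C : Parts n) → Dec (v ∈ᵥ C)
x i ∈ᵥ? (A , B) = i ∈? A
y j ∈ᵥ? (A , B) = j ∈? B

-- A complete bipartite subgraph of G(n) has both sides nonempty; one-sided
-- vertex sets cover no edge, so admitting them would not change `r`.
IsBiclique : Parts n → Set
IsBiclique (A , B) = Nonempty A × Nonempty B × (∀ i j → i ∈ A → j ∈ B → Edge i j)

load : Vertex n → List (Parts n) → ℕ
load v Cs = length (filter (v ∈ᵥ?_) Cs)

record IsCover (n k : ℕ) (Cs : List (Parts n)) : Set where
  field
    bicliques : All IsBiclique Cs
    covers    : ∀ i j → Edge i j → Any (λ C → x i ∈ᵥ C × y j ∈ᵥ C) Cs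
    load≤     : ∀ v → load v Cs ≤ k

Coverable : ℕ → ℕ → Set
Coverable n k = ∃[ Cs ] IsCover n k Cs

-- The remainder shows that `Coverable n` is decidable and inhabited, so that its
-- least element `r n` exists.

isBiclique? : Decidable (IsBiclique {n})
isBiclique? (A , B) = nonempty? A ×-dec nonempty? B ×-dec
  Finₚ.all? λ i → Finₚ.all? λ j → (i ∈? A) →-dec ((j ∈? B) →-dec (i Fin.≤? j))

isCover? : ∀ n k → Decidable (IsCover n k)
isCover? n k Cs = map′
  (λ (b , c , lx , ly) → record
    { bicliques = b ; covers = c ; load≤ = λ { (x i) → lx i ; (y j) → ly j } })
  (λ cov → let open IsCover cov in bicliques , covers , load≤ ∘ x , load≤ ∘ y)
  (all? isBiclique? Cs
    ×-dec (Finₚ.all? λ i → Finₚ.all? λ j →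
            (i Fin.≤? j) →-dec any? (λ C → (x i ∈ᵥ? C) ×-dec (y j ∈ᵥ? C)) Cs)
    ×-dec (Finₚ.all? λ i → load (x i) Cs ≤? k)
    ×-dec (Finₚ.all? λ j → load (y j) Cs ≤? k))

anyParts? : {P : Pred (Parts n) 0ℓ} → Decidable P → Dec (∃ P)
anyParts? P? = map′ (λ (A , B , p) → (A , B) , p) (λ ((A , B) , p) → A , B , p)
  (anySubset? λ A → anySubset? λ B → P? (A , B))

anyList? : ∀ m {P : Pred (List (Parts n)) 0ℓ} → Decidable P →
           Dec (∃[ Cs ] length Cs ≤ m × P Cs)
anyList? zero P? = map′ (λ p → [] , z≤n , p) (λ { ([] , _ , p) → p }) (P? [])
anyList? (suc m) {P} P? with P? []
... | yes p = yes ([] , z≤n , p)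
... | no ¬p = map′
  (λ (C , Cs , l , p) → C ∷ Cs , s≤s l , p)
  (λ { ([] , _ , p) → contradiction p ¬p
     ; (C ∷ Cs , s≤s l , p) → C , Cs , l , p })
  (anyParts? λ C → anyList? m (P? ∘ (C ∷_)))

sumF : ∀ n → (Fin n → ℕ) → ℕ
sumF zero    f = 0
sumF (suc n) f = f zero + sumF n (f ∘ suc)

sumF-mono : ∀ n {f g : Fin n → ℕ} → (∀ i → f i ≤ g i) → sumF n f ≤ sumF n g
sumF-mono zero    f≤g = z≤n
sumF-mono (suc n) f≤g = ℕₚ.+-mono-≤ (f≤g zero) (sumF-mono n (f≤g ∘ suc))

sumF-mono-< : ∀ n {f g : Fin n → ℕ} → (∀ i → f i ≤ g i) →
              ∀ i → f i < g i → sumF n f < sumF n g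
sumF-mono-< (suc n) f≤g zero    lt = ℕₚ.+-mono-<-≤ lt (sumF-mono n (f≤g ∘ suc))
sumF-mono-< (suc n) f≤g (suc i) lt =
  ℕₚ.+-mono-≤-< (f≤g zero) (sumF-mono-< n (f≤g ∘ suc) i lt)

sumF-bound : ∀ n (f : Fin n → ℕ) → (∀ i → f i ≤ k) → sumF n f ≤ n * k
sumF-bound zero    f f≤k = z≤n
sumF-bound (suc n) f f≤k = ℕₚ.+-mono-≤ (f≤k zero) (sumF-bound n (f ∘ suc) (f≤k ∘ suc))

load-∷-≤ : ∀ (v : Vertex n) C Cs → load v Cs ≤ load v (C ∷ Cs)
load-∷-≤ v C Cs with v ∈ᵥ? C
... | yes p = ℕₚ.n≤1+n _
... | no ¬p = ℕₚ.≤-refl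

load-∷-< : ∀ (v : Vertex n) C Cs → v ∈ᵥ C → load v Cs < load v (C ∷ Cs)
load-∷-< v C Cs p with v ∈ᵥ? C
... | yes _ = ℕₚ.≤-refl
... | no ¬p = contradiction p ¬p

length≤sum-load : (Cs : List (Parts n)) → All IsBiclique Cs →
                  length Cs ≤ sumF n (λ i → load (x i) Cs)
length≤sum-load [] _ = z≤n
length≤sum-load (C ∷ Cs) (((i , i∈A) , _) All.∷ bs) =
  ℕₚ.≤-trans (s≤s (length≤sum-load Cs bs))
    (sumF-mono-< _ (λ i → load-∷-≤ (x i) C Cs) i (load-∷-< (x i) C Cs i∈A))

cover-length : ∀ {Cs} → IsCover n k Cs → length Cs ≤ n * k
cover-length {n} {Cs = Cs} cov =
  ℕₚ.≤-trans (length≤sum-load Cs bicliques) (sumF-bound n _ (load≤ ∘ x))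
  where open IsCover cov

coverable? : ∀ n → Decidable (Coverable n)
coverable? n k = map′
  (λ (Cs , _ , cov) → Cs , cov)
  (λ (Cs , cov) → Cs , cover-length cov , cov)
  (anyList? (n * k) (isCover? n k))

private
  edge? : Decidable (uncurry (Edge {n}))
  edge? (i , j) = i Fin.≤? j

edges : ∀ n → List (Fin n × Fin n)
edges n = filter edge? (cartesianProduct (allFin n) (allFin n))

singleEdge : Fin n × Fin n → Parts n
singleEdge (i , j) = ⁅ i ⁆ , ⁅ j ⁆

singleEdge-isBiclique : ∀ {e : Fin n × Fin n} → uncurry Edge e → IsBiclique (singleEdge e)
singleEdge-isBiclique {e = i , j} i≤j = (i , x∈⁅x⁆ i) , (j , x∈⁅x⁆ j) , λ a b a∈ b∈ →
  subst (λ a → Edge a b) (sym (x∈⁅y⁆⇒x≡y i a∈))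
    (subst (Edge i) (sym (x∈⁅y⁆⇒x≡y j b∈)) i≤j)

trivialCover : ∀ n → ∃ (Coverable n)
trivialCover n = length Cs , Cs , record
  { bicliques = Allₚ.map⁺ (All.map singleEdge-isBiclique
      (Allₚ.all-filter edge? (cartesianProduct (allFin n) (allFin n))))
  ; covers    = λ i j i≤j → Anyₚ.map⁺ (Any.map (λ { refl → x∈⁅x⁆ i , x∈⁅x⁆ j })
      (∈-filter⁺ edge? (∈-cartesianProduct⁺ (∈-allFin i) (∈-allFin j)) i≤j))
  ; load≤     = λ v → Listₚ.length-filter (v ∈ᵥ?_) Cs
  }
  where Cs = map singleEdge (edges n)

IsLeast : Pred ℕ 0ℓ → ℕ → Set
IsLeast P m = P m × (∀ k → P k → m ≤ k)

least : {P : Pred ℕ 0ℓ} → Decidable P → ∀ b → P b → ∃ (IsLeast P)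
least P? b p with P? 0
least P? b       p | yes p₀ = 0 , p₀ , λ _ _ → z≤n
least P? zero    p | no ¬p₀ = contradiction p ¬p₀
least P? (suc b) p | no ¬p₀ with least (P? ∘ suc) b p
... | m , pₘ , min = suc m , pₘ , λ { zero p₀ → contradiction p₀ ¬p₀ ; (suc k) pₖ → s≤s (min k pₖ) }

abstract
  ∃-least-coverable : ∀ n → ∃ (IsLeast (Coverable n))
  ∃-least-coverable n = uncurry (least (coverable? n)) (trivialCover n)

r : ℕ → ℕ
r n = proj₁ (∃-least-coverable n)

r-isLeast : ∀ n → IsLeast (Coverable n) (r n)
r-isLeast n = proj₂ (∃-least-coverable n)

-- Split the indices 1, …, m + p of G(m + p) into the first m and the last p. The
-- edges from the first x's to the last y's form one biclique containing every
-- vertex at most once, and what remains is a disjoint copy of G(m) and G(p).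
-- Hence r (m + p) ≤ 1 + max (r m) (r p); halving n repeatedly gives the bound.

module Submission where

open import Defs
open import Data.Nat using (ℕ; zero; suc; _+_; _^_; _≤_; _<_; NonZero; z≤n; s≤s; s≤s⁻¹; ⌊_/2⌋; ⌈_/2⌉)
open import Data.Nat.Logarithm using (⌈log₂_⌉; ⌈log₂⌉-mono-≤; ⌈log₂⌈n/2⌉⌉≡⌈log₂n⌉∸1; ⌈log₂2^n⌉≡n)
open import Data.Nat.Properties
  using (≤-refl; ≤-trans; <-≤-trans; <⇒≤; <⇒≱; n≤1+n; m≤m+n; +-comm; +-identityʳ; +-cancelˡ-≤;
         +-monoʳ-≤; m^n≢0; ⌊n/2⌋≤⌈n/2⌉; ⌊n/2⌋+⌈n/2⌉≡n; module ≤-Reasoning)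
open import Data.Fin as Fin using (Fin; zero; suc; _↑ˡ_; _↑ʳ_; toℕ; splitAt)
open import Data.Fin.Properties using (toℕ-↑ˡ; toℕ-↑ʳ; toℕ<n; splitAt⁻¹-↑ˡ; splitAt⁻¹-↑ʳ)
open import Data.Fin.Subset using (⊤; ⊥)
open import Data.Fin.Subset.Properties using (∉⊥; ∈⊤)
open import Data.List using ([]; _∷_; _++_; filter; map)
open import Data.List.Properties using (filter-++; length-++)
open import Data.List.Relation.Unary.All as All using ([]; _∷_)
import Data.List.Relation.Unary.All.Properties as All
open import Data.List.Relation.Unary.Any as Any using (here; there)
import Data.List.Relation.Unary.Any.Properties as Any
open import Data.Product using (_×_; _,_; proj₂)
import Data.Product as Product
open import Data.Sum using (inj₁; inj₂)
open import Data.Vec as Vec using (Vec; _[_]=_)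
open import Data.Vec.Properties using (lookup-++ˡ; lookup-++ʳ; []=⇒lookup; lookup⇒[]=)
open import Function using (_∘_; _⇔_; mk⇔; Equivalence)
open import Relation.Binary.PropositionalEquality
  using (_≡_; refl; sym; trans; cong; cong₂; subst; subst₂)
open import Relation.Nullary using (¬_; yes; no; contradiction)

open Equivalence using (to; from)

private
  variable
    m n p k : ℕ

-- Since `i ∈ A` unfolds to `A [ i ]= inside`, this and the next lemma read membership in a
-- concatenation of two subsets off its blocks.
[]=-++ˡ : ∀ {A : Set} {a} (xs : Vec A m) (ys : Vec A p) i →
          (xs Vec.++ ys) [ i ↑ˡ p ]= a ⇔ xs [ i ]= a
[]=-++ˡ xs ys i = mk⇔
  (λ q → lookup⇒[]= i xs (trans (sym (lookup-++ˡ xs ys i)) ([]=⇒lookup q)))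
  (λ q → lookup⇒[]= _ (xs Vec.++ ys) (trans (lookup-++ˡ xs ys i) ([]=⇒lookup q)))

[]=-++ʳ : ∀ {A : Set} {a} (xs : Vec A m) (ys : Vec A p) i →
          (xs Vec.++ ys) [ m ↑ʳ i ]= a ⇔ ys [ i ]= a
[]=-++ʳ xs ys i = mk⇔
  (λ q → lookup⇒[]= i ys (trans (sym (lookup-++ʳ xs ys i)) ([]=⇒lookup q)))
  (λ q → lookup⇒[]= _ (xs Vec.++ ys) (trans (lookup-++ʳ xs ys i) ([]=⇒lookup q)))

-- A view: matching on it puts the index in the form `i ↑ˡ p` or `m ↑ʳ j` in the goal and all
-- hypotheses at once.
data Split (m p : ℕ) : Fin (m + p) → Set where
  low  : ∀ i → Split m p (i ↑ˡ p)
  high : ∀ j → Split m p (m ↑ʳ j)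

split : ∀ m (i : Fin (m + p)) → Split m p i
split {p} m i with splitAt m i in eq
... | inj₁ j = subst (Split m p) (splitAt⁻¹-↑ˡ eq) (low j)
... | inj₂ j = subst (Split m p) (splitAt⁻¹-↑ʳ {m} eq) (high j)

↑ˡ-≤ : (i j : Fin m) → Edge (i ↑ˡ p) (j ↑ˡ p) ⇔ Edge i j
↑ˡ-≤ {p = p} i j = mk⇔ (subst₂ _≤_ (toℕ-↑ˡ i p) (toℕ-↑ˡ j p))
                       (subst₂ _≤_ (sym (toℕ-↑ˡ i p)) (sym (toℕ-↑ˡ j p)))

↑ʳ-≤ : ∀ m (i j : Fin p) → Edge (m ↑ʳ i) (m ↑ʳ j) ⇔ Edge i j
↑ʳ-≤ m i j = mk⇔
  (+-cancelˡ-≤ m _ _ ∘ subst₂ _≤_ (toℕ-↑ʳ m i) (toℕ-↑ʳ m j))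
  (subst₂ _≤_ (sym (toℕ-↑ʳ m i)) (sym (toℕ-↑ʳ m j)) ∘ +-monoʳ-≤ m)

-- Makes every low `x` adjacent to every high `y`; strictness also excludes every edge between a
-- high `x` and a low `y`.
↑ˡ<↑ʳ : (i : Fin m) (j : Fin p) → i ↑ˡ p Fin.< m ↑ʳ j
↑ˡ<↑ʳ {m} {p} i j = subst₂ _<_ (sym (toℕ-↑ˡ i p)) (sym (toℕ-↑ʳ m j))
  (<-≤-trans (toℕ<n i) (m≤m+n m (toℕ j)))

mapᵥ : (Fin m → Fin n) → Vertex m → Vertex n
mapᵥ f (x i) = x (f i)
mapᵥ f (y j) = y (f j)

padʳ : ∀ p → Parts m → Parts (m + p)
padʳ p (A , B) = A Vec.++ ⊥ {p} , B Vec.++ ⊥ {p}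

padˡ : ∀ m → Parts p → Parts (m + p)
padˡ m (A , B) = ⊥ {m} Vec.++ A , ⊥ {m} Vec.++ B

cross : ∀ m p → Parts (m + p)
cross m p = ⊤ {m} Vec.++ ⊥ {p} , ⊥ {m} Vec.++ ⊤ {p}

low∈padʳ : ∀ v (C : Parts m) → mapᵥ (_↑ˡ p) v ∈ᵥ padʳ p C ⇔ v ∈ᵥ C
low∈padʳ (x i) (A , B) = []=-++ˡ A ⊥ i
low∈padʳ (y j) (A , B) = []=-++ˡ B ⊥ j

high∈padˡ : ∀ v (C : Parts p) → mapᵥ (m ↑ʳ_) v ∈ᵥ padˡ m C ⇔ v ∈ᵥ C
high∈padˡ (x i) (A , B) = []=-++ʳ ⊥ A i
high∈padˡ (y j) (A , B) = []=-++ʳ ⊥ B j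

-- The filler is `⊥`. This and `low∉padˡ` keep the loads of the two padded covers from adding up.
high∉padʳ : ∀ v (C : Parts m) → ¬ mapᵥ (m ↑ʳ_) v ∈ᵥ padʳ p C
high∉padʳ (x i) (A , B) = ∉⊥ ∘ to ([]=-++ʳ A ⊥ i)
high∉padʳ (y j) (A , B) = ∉⊥ ∘ to ([]=-++ʳ B ⊥ j)

low∉padˡ : ∀ v (C : Parts p) → ¬ mapᵥ (_↑ˡ p) v ∈ᵥ padˡ m C
low∉padˡ (x i) (A , B) = ∉⊥ ∘ to ([]=-++ˡ ⊥ A i)
low∉padˡ (y j) (A , B) = ∉⊥ ∘ to ([]=-++ˡ ⊥ B j)

padʳ-isBiclique : {C : Parts m} → IsBiclique C → IsBiclique (padʳ p C)
padʳ-isBiclique {m} {p} {C} ((i , i∈) , (j , j∈) , complete) =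
  (i ↑ˡ p , from (low∈padʳ (x i) C) i∈) , (j ↑ˡ p , from (low∈padʳ (y j) C) j∈) , edge
  where
  edge : ∀ i j → x i ∈ᵥ padʳ p C → y j ∈ᵥ padʳ p C → Edge i j
  edge i j i∈ j∈ with split m i | split m j
  ... | low i  | low j  = from (↑ˡ-≤ i j)
    (complete i j (to (low∈padʳ (x i) C) i∈) (to (low∈padʳ (y j) C) j∈))
  ... | high i | _      = contradiction i∈ (high∉padʳ (x i) C)
  ... | low _  | high j = contradiction j∈ (high∉padʳ (y j) C)

padˡ-isBiclique : {C : Parts p} → IsBiclique C → IsBiclique (padˡ m C)
padˡ-isBiclique {p} {m} {C} ((i , i∈) , (j , j∈) , complete) =
  (m ↑ʳ i , from (high∈padˡ (x i) C) i∈) , (m ↑ʳ j , from (high∈padˡ (y j) C) j∈) , edge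
  where
  edge : ∀ i j → x i ∈ᵥ padˡ m C → y j ∈ᵥ padˡ m C → Edge i j
  edge i j i∈ j∈ with split m i | split m j
  ... | high i | high j = from (↑ʳ-≤ m i j)
    (complete i j (to (high∈padˡ (x i) C) i∈) (to (high∈padˡ (y j) C) j∈))
  ... | low i  | _      = contradiction i∈ (low∉padˡ (x i) C)
  ... | high _ | low j  = contradiction j∈ (low∉padˡ (y j) C)

low∈cross : (i : Fin m) → x (i ↑ˡ p) ∈ᵥ cross m p
low∈cross i = from ([]=-++ˡ ⊤ ⊥ i) ∈⊤

high∈cross : (j : Fin p) → y (m ↑ʳ j) ∈ᵥ cross m p
high∈cross {m = m} j = from ([]=-++ʳ (⊥ {m}) ⊤ j) ∈⊤

-- The sizes are successors because both sides of a biclique must be nonempty.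
cross-isBiclique : ∀ m p → IsBiclique (cross (suc m) (suc p))
cross-isBiclique m p =
  (_ , low∈cross {suc m} zero) , (_ , high∈cross {m = suc m} zero) , edge
  where
  edge : ∀ i j → x i ∈ᵥ cross (suc m) (suc p) → y j ∈ᵥ cross (suc m) (suc p) → Edge i j
  edge i j i∈ j∈ with split (suc m) i | split (suc m) j
  ... | low i  | high j = <⇒≤ (↑ˡ<↑ʳ i j)
  ... | high i | _      = contradiction (to ([]=-++ʳ (⊤ {suc m}) ⊥ i) i∈) ∉⊥
  ... | low _  | low j  = contradiction (to ([]=-++ˡ (⊥ {suc m}) ⊤ j) j∈) ∉⊥

load-∷-≤-suc : ∀ (v : Vertex n) C Cs → load v (C ∷ Cs) ≤ suc (load v Cs)
load-∷-≤-suc v C Cs with v ∈ᵥ? C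
... | yes _ = ≤-refl
... | no  _ = n≤1+n _

load-++ : ∀ (v : Vertex n) Cs Ds → load v (Cs ++ Ds) ≡ load v Cs + load v Ds
load-++ v Cs Ds rewrite filter-++ (v ∈ᵥ?_) Cs Ds = length-++ (filter (v ∈ᵥ?_) Cs)

-- The load depends only on which members contain the vertex, and the hypothesis makes the two
-- membership tests agree on each member.
load-map : ∀ {v : Vertex m} {w : Vertex n} {f : Parts m → Parts n} →
           (∀ C → w ∈ᵥ f C ⇔ v ∈ᵥ C) → ∀ Cs → load w (map f Cs) ≡ load v Cs
load-map w⇔v [] = refl
load-map {v = v} {w} {f} w⇔v (C ∷ Cs) with w ∈ᵥ? f C | v ∈ᵥ? C
... | yes _  | yes _  = cong suc (load-map w⇔v Cs)
... | no  _  | no  _  = load-map w⇔v Cs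
... | yes w∈ | no v∉  = contradiction (to (w⇔v C) w∈) v∉
... | no w∉  | yes v∈ = contradiction (from (w⇔v C) v∈) w∉

load-map-∉ : ∀ {w : Vertex n} {f : Parts m → Parts n} →
             (∀ C → ¬ w ∈ᵥ f C) → ∀ Cs → load w (map f Cs) ≡ 0
load-map-∉ w∉ [] = refl
load-map-∉ {w = w} {f} w∉ (C ∷ Cs) with w ∈ᵥ? f C
... | yes w∈ = contradiction w∈ (w∉ C)
... | no  _  = load-map-∉ w∉ Cs

-- A common `k` stands in for the maximum: each vertex lies in one block only, whose cover loads it
-- at most `k` times, and `cross` adds at most one.
coverable-+ : Coverable (suc m) k → Coverable (suc p) k → Coverable (suc m + suc p) (suc k)
coverable-+ {m} {k} {p} (Cs , covC) (Ds , covD) = cross M P ∷ rest , record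
  { bicliques = cross-isBiclique m p ∷ All.++⁺
      (All.map⁺ (All.map padʳ-isBiclique C.bicliques))
      (All.map⁺ (All.map padˡ-isBiclique D.bicliques))
  ; covers = covers
  ; load≤ = λ v → ≤-trans (load-∷-≤-suc v (cross M P) rest) (s≤s (load-rest v))
  }
  where
  open ≤-Reasoning
  module C = IsCover covC
  module D = IsCover covD
  M = suc m
  P = suc p
  rest = map (padʳ P) Cs ++ map (padˡ M) Ds

  covers : ∀ i j → Edge i j → Any.Any (λ C → x i ∈ᵥ C × y j ∈ᵥ C) (cross M P ∷ rest)
  covers i j i≤j with split M i | split M j
  ... | low i  | low j  = there (Any.++⁺ˡ (Any.map⁺ (Any.map
    (λ {C} → Product.map (from (low∈padʳ (x i) C)) (from (low∈padʳ (y j) C)))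
    (C.covers i j (to (↑ˡ-≤ i j) i≤j)))))
  ... | low i  | high j = here (low∈cross i , high∈cross {m = M} j)
  ... | high i | low j  = contradiction i≤j (<⇒≱ (↑ˡ<↑ʳ j i))
  ... | high i | high j = there (Any.++⁺ʳ (map (padʳ P) Cs) (Any.map⁺ (Any.map
    (λ {C} → Product.map (from (high∈padˡ (x i) C)) (from (high∈padˡ (y j) C)))
    (D.covers i j (to (↑ʳ-≤ M i j) i≤j)))))

  load-low : ∀ v → load (mapᵥ (_↑ˡ P) v) rest ≤ k
  load-low v = begin
    load w rest                                         ≡⟨ load-++ w (map (padʳ P) Cs) _ ⟩
    load w (map (padʳ P) Cs) + load w (map (padˡ M) Ds) ≡⟨ cong₂ _+_ (load-map (low∈padʳ v) Cs) (load-map-∉ (low∉padˡ v) Ds) ⟩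
    load v Cs + 0                                       ≡⟨ +-identityʳ _ ⟩
    load v Cs                                           ≤⟨ C.load≤ v ⟩
    k                                                   ∎
    where w = mapᵥ (_↑ˡ P) v

  load-high : ∀ v → load (mapᵥ (M ↑ʳ_) v) rest ≤ k
  load-high v = begin
    load w rest                                         ≡⟨ load-++ w (map (padʳ P) Cs) _ ⟩
    load w (map (padʳ P) Cs) + load w (map (padˡ M) Ds) ≡⟨ cong₂ _+_ (load-map-∉ (high∉padʳ v) Cs) (load-map (high∈padˡ v) Ds) ⟩
    -- The preceding sum `0 + load v Ds` reduces by computation, so no identity law intervenes as in
    -- `load-low`.
    load v Ds                                           ≤⟨ D.load≤ v ⟩
    k                                                   ∎
    where w = mapᵥ (M ↑ʳ_) v

  load-rest : ∀ v → load v rest ≤ k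
  load-rest (x i) with split M i
  ... | low i  = load-low (x i)
  ... | high i = load-high (x i)
  load-rest (y j) with split M j
  ... | low j  = load-low (y j)
  ... | high j = load-high (y j)

-- The bound is any `suc k` because uneven halving can reach size one with budget left over.
coverable-1 : ∀ k → Coverable 1 (suc k)
coverable-1 k = singleEdge (zero , zero) ∷ [] , record
  { bicliques = singleEdge-isBiclique {e = zero , zero} z≤n ∷ []
  ; covers    = λ { zero zero _ → here (Vec.here , Vec.here) }
  ; load≤     = λ v → ≤-trans (load-∷-≤-suc v (singleEdge (zero , zero)) []) (s≤s z≤n)
  }

-- Recursion on the budget `q` is structural although the size is halved. For `q` zero and size at
-- least two the hypothesis is absurd, as the logarithm computes to a successor.
coverable-log : ∀ q n → ⌈log₂ suc n ⌉ ≤ q → Coverable (suc n) (suc q)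
coverable-log q       zero    _     = coverable-1 q
coverable-log (suc q) (suc n) log≤ =
  -- The halves of `2 + n` compute to `suc ⌊ n /2⌋` and `suc ⌈ n /2⌉`, the successor form that
  -- `coverable-+` takes. The smaller half inherits its bound from the larger by monotonicity.
  subst (λ N → Coverable N (2 + q)) (⌊n/2⌋+⌈n/2⌉≡n (2 + n))
    (coverable-+ (coverable-log q ⌊ n /2⌋ (≤-trans (⌈log₂⌉-mono-≤ (⌊n/2⌋≤⌈n/2⌉ (2 + n))) half))
                 (coverable-log q ⌈ n /2⌉ half))
  where
  half : ⌈log₂ ⌈ 2 + n /2⌉ ⌉ ≤ q
  -- The logarithm of `2 + n` is a successor, so the truncated `∸ 1` is exact and cancels the `suc`
  -- of `suc q`.
  half rewrite ⌈log₂⌈n/2⌉⌉≡⌈log₂n⌉∸1 (2 + n) = s≤s⁻¹ log≤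

r≤1+⌈log₂⌉ : ∀ n .{{_ : NonZero n}} → r n ≤ 1 + ⌈log₂ n ⌉
r≤1+⌈log₂⌉ n@(suc n-1) = proj₂ (r-isLeast n) _ (coverable-log ⌈log₂ n ⌉ n-1 ≤-refl)

corollary3p3 : (∀ (q : ℕ) → r (2 ^ q) ≤ q + 1) × (∀ (n : ℕ) .{{_ : NonZero n}} → r n ≤ 1 + ⌈log₂ n ⌉)
corollary3p3 = r-2^q≤ , r≤1+⌈log₂⌉
  where
  r-2^q≤ : ∀ q → r (2 ^ q) ≤ q + 1
  -- The general bound at a power of two, where the rounded logarithm is `q` itself.
  r-2^q≤ q = subst (r (2 ^ q) ≤_) (trans (cong suc (⌈log₂2^n⌉≡n q)) (+-comm 1 q))
    (r≤1+⌈log₂⌉ (2 ^ q) {{m^n≢0 2 q}})
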